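{- Let $n$ be a positive integer. The map $\zeta$ (defined in the context) is a bijection from the set of pairs $(P,Q)$ of noncrossing free Dyck paths of length $2n$ onto the set of noncrossing partitions of $[2n+1]=\{1,2,\ldots,2n+1\}$ with exactly $n+1$ blocks.
   Context: **Paths.** A free Dyck path of length $2n$ is a lattice path from $(0,0)$ to $(2n,0)$ with up steps $U=(1,1)$ and down steps $D=(1,-1)$; it is represented as a sequence of $n$ letters $U$ and $n$ letters $D$. It is allowed to go below the $x$-axis. A pair of noncrossing free Dyck paths of length $2n$ is an ordered pair $(P,Q)$ of free Dyck paths of length $2n$ such that $P$ never goes below $Q$ (they may touch or share steps). **Set partitions.** The standard representation of a partition $R$ of $[m]=\{1,\ldots,m\}$ is the graph on $[m]$ in which each block $\{i_1<i_2<\cdots<i_k\}$ contributes the arcs $(i_1,i_2),(i_2,i_3),\ldots,(i_{k-1},i_k)$. The partition $R$ is noncrossing if its standard representation contains no two arcs $(i_1,j_1),(i_2,j_2)$ with $i_1<i_2<j_1<j_2$. **Vacillating tableaux.** A vacillating tableau of length $2m$ and empty shape is a sequence $(\lambda^0,\lambda^1,\ldots,\lambda^{2m})$ of integer partitions (Young diagrams) with $\lambda^0=\lambda^{2m}=\emptyset$, where $\lambda^{2i+1}$ is equal to $\lambda^{2i}$ or obtained from it by deleting a square, and $\lambda^{2i}$ is equal to $\lambda^{2i-1}$ or obtained from it by adding a square. **From vacillating tableaux to set partitions.** Given such a vacillating tableau, define recursively tableaux $T_0,T_1,\ldots,T_{2m}$, where $T_i$ is a standard Young tableau (on a suitable alphabet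 of distinct positive integers) of shape $\lambda^i$ and $T_0$ is empty: 1. If $\lambda^i=\lambda^{i-1}$, then $T_i=T_{i-1}$. 2. If $\lambda^i\supsetneq\lambda^{i-1}$, then $i=2k$ for some $k\in[m]$, and $T_i$ is obtained from $T_{i-1}$ by adding the entry $k$ in the square $\lambda^i\setminus\lambda^{i-1}$. 3. If $\lambda^i\subsetneq\lambda^{i-1}$, then $i=2k-1$ for some $k\in[m]$, and $T_i$ is the unique standard Young tableau (on a suitable alphabet) of shape $\lambda^i$ such that $T_{i-1}$ is obtained from $T_i$ by RSK row insertion of some element $j$. In this case record the arc $(j,k)$. The recorded arcs form the standard representation of a partition of $[m]$, which is the partition corresponding to the vacillating tableau. **The map $\zeta$.** Let $(P,Q)$ be a pair of noncrossing free Dyck paths of length $2n$, with $P=p_1p_2\cdots p_{2n}$ and $Q=q_1q_2\cdots q_{2n}$. Construct a sequence $(\lambda^0,\lambda^1,\ldots,\lambda^{4n+2})$ of shapes, each with at most one row, by setting $\lambda^0=\lambda^1=\lambda^{4n+2}=\emptyset$ and, for $1\le i\le 2n$: - if $(p_i,q_i)=(U,U)$, then $\lambda^{2i}$ is obtained from $\lambda^{2i-1}$ by adding one square and $\lambda^{2i+1}$ is obtained from $\lambda^{2i}$ by deleting one square; - if $(p_i,q_i)=(U,D)$, then $\lambda^{2i}$ is obtained from $\lambda^{2i-1}$ by adding one square and $\lambda^{2i+1}=\lambda^{2i}$; - if $(p_i,q_i)=(D,U)$, then $\lambda^{2i}=\lambda^{2i-1}$ and $\lambda^{2i+1}$ is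 obtained from $\lambda^{2i}$ by deleting one square; - if $(p_i,q_i)=(D,D)$, then $\lambda^{2i-1}=\lambda^{2i}=\lambda^{2i+1}$. Then $\zeta(P,Q)$ is the partition of $[2n+1]$ corresponding, by the procedure above with $m=2n+1$, to this vacillating tableau of length $4n+2$ and empty shape. -}

module Defs where

open import Data.Nat using (ℕ; zero; suc; _+_; _*_; _<_; _≤_; _>_; _≥_; pred; z≤n; s≤s; _<?_)
import Data.Nat.Properties as ℕ
open import Data.Integer as ℤ using (ℤ; 0ℤ; 1ℤ; -1ℤ; +_; +≤+)
import Data.Integer.Properties as ℤ
open import Data.Integer.Tactic.RingSolver using (solve-∀)
open import Data.Fin using (Fin; zero; suc; fromℕ)
open import Data.Vec as Vec using (Vec; []; _∷_)
open import Data.Vec.Relation.Unary.All as VecAll using ([]; _∷_)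
open import Data.List using (List; []; _∷_; [_]; _++_; _∷ʳ_; length; map; concat; concatMap; applyUpTo)
import Data.List.Properties as List
open import Data.List.Relation.Unary.All as All using (All; []; _∷_)
import Data.List.Relation.Unary.All.Properties as All
import Data.List.Relation.Unary.AllPairs as AllPairs
open import Data.List.Relation.Unary.Linked using (Linked; []; [-]; _∷_)
open import Data.List.Relation.Unary.Linked.Properties using (Linked⇒AllPairs)
open import Data.List.Relation.Unary.Unique.Propositional using (Unique)
open import Data.List.Relation.Binary.Prefix.Heterogeneous using (Prefix)
open import Data.List.Relation.Binary.Permutation.Propositional
  using (_↭_; ↭-refl; ↭-sym; ↭-trans; ↭-reflexive; refl; prep; swap; trans; module PermutationReasoning)
import Data.List.Relation.Binary.Permutation.Propositional.Properties as Perm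
open import Data.List.Membership.Propositional using (_∈_)
open import Data.Maybe using (Maybe; just; nothing)
open import Data.Product using (_×_; _,_; proj₁; proj₂; ∃-syntax; Σ-syntax)
open import Data.Sum using (_⊎_; inj₁; inj₂)
open import Function using (_∘_)
open import Relation.Nullary using (¬_; yes; no; contradiction)
open import Relation.Binary.PropositionalEquality
  using (_≡_; _≢_; refl; sym; cong; cong₂; subst; subst₂; module ≡-Reasoning)
  renaming (trans to ≡-trans)

------------------------------------------------------------------------
-- Paths

data Step : Set where
  U D : Step

rise : Step → ℤ
rise U = 1ℤ
rise D = -1ℤ

-- height p x is the ordinate of the path p, started on the axis, at
-- abscissa x.
height : ∀ {l} → Vec Step l → Fin (suc l) → ℤ
height _       zero    = 0ℤ
height (s ∷ p) (suc x) = rise s ℤ.+ height p x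

record FreeDyckPath (n : ℕ) : Set where
  field
    steps   : Vec Step (2 * n)
    returns : height steps (fromℕ (2 * n)) ≡ 0ℤ

open FreeDyckPath public

-- It suffices to compare heights at integer abscissae, both paths being
-- affine in between.
NeverBelow : ∀ {n} → FreeDyckPath n → FreeDyckPath n → Set
NeverBelow P Q = ∀ x → height (steps Q) x ℤ.≤ height (steps P) x

record NoncrossingPair (n : ℕ) : Set where
  field
    upper lower : FreeDyckPath n
    noncrossing : NeverBelow upper lower

open NoncrossingPair public

-- Equality of pairs of paths, disregarding the proof components.
_≈ᴾ_ : ∀ {n} → NoncrossingPair n → NoncrossingPair n → Set
X ≈ᴾ Y = steps (upper X) ≡ steps (upper Y) × steps (lower X) ≡ steps (lower Y)

------------------------------------------------------------------------
-- Set partitions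

Arc : Set
Arc = ℕ × ℕ

-- A block is written as the increasing list of its elements.
record SetPartition (m : ℕ) : Set where
  field
    blocks     : List (List ℕ)
    nonempty   : All (_≢ []) blocks
    increasing : All (Linked _<_) blocks
    covers     : concat blocks ↭ applyUpTo suc m   -- 1 ∷ 2 ∷ … ∷ m ∷ []

open SetPartition public

-- Equality of partitions as sets of blocks: the order in which the blocks
-- are listed is immaterial.
_≈_ : ∀ {m} → SetPartition m → SetPartition m → Set
R ≈ S = blocks R ↭ blocks S

blockArcs : List ℕ → List Arc
blockArcs (i ∷ j ∷ b) = (i , j) ∷ blockArcs (j ∷ b)
blockArcs _           = []

standardRep : ∀ {m} → SetPartition m → List Arc
standardRep R = concatMap blockArcs (blocks R)

Noncrossing : ∀ {m} → SetPartition m → Set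
Noncrossing R = ∀ i₁ j₁ i₂ j₂ →
  (i₁ , j₁) ∈ standardRep R → (i₂ , j₂) ∈ standardRep R →
  ¬ (i₁ < i₂ × i₂ < j₁ × j₁ < j₂)

-- Noncrossing partitions of [m] with exactly k blocks.
NC : ℕ → ℕ → Set
NC m k = Σ[ R ∈ SetPartition m ] Noncrossing R × length (blocks R) ≡ k

_≈ᴺ_ : ∀ {m k} → NC m k → NC m k → Set
X ≈ᴺ Y = proj₁ X ≈ proj₁ Y

------------------------------------------------------------------------
-- Vacillating tableaux

Shape : Set
Shape = List ℕ

IsPartition : Shape → Set
IsPartition rows = Linked _≥_ rows × All (0 <_) rows

infix 4 _⋖_

-- κ ⋖ κ′: the diagram κ′ is κ with one square added.
data _⋖_ : Shape → Shape → Set where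
  new  : [] ⋖ 1 ∷ []
  here : ∀ {r κ} → r ∷ κ ⋖ suc r ∷ κ
  down : ∀ {r κ κ′} → κ ⋖ κ′ → r ∷ κ ⋖ r ∷ κ′

data Vacillates : ∀ {m} → Vec Shape (suc (m * 2)) → Set where
  end  : Vacillates {0} ([] ∷ [])
  step : ∀ {m κ μ ν} {κs : Vec Shape (m * 2)} →
         μ ≡ κ ⊎ μ ⋖ κ →
         ν ≡ μ ⊎ μ ⋖ ν →
         Vacillates {m} (ν ∷ κs) →
         Vacillates {suc m} (κ ∷ μ ∷ ν ∷ κs)

-- Length 2m and empty shape.
record VacillatingTableau (m : ℕ) : Set where
  field
    shapes     : Vec Shape (suc (m * 2))
    partitions : VecAll.All IsPartition shapes
    starts     : Vec.head shapes ≡ []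
    vacillates : Vacillates {m} shapes

open VacillatingTableau public

------------------------------------------------------------------------
-- Standard Young tableaux and row insertion

-- The list of rows, in English notation.
Tableau : Set
Tableau = List (List ℕ)

shape : Tableau → Shape
shape = map length

-- Consecutive rows r, s are column-strict when s is no longer than r and
-- each entry of s exceeds the one of r above it.
record IsStandard (T : Tableau) : Set where
  field
    diagram  : IsPartition (shape T)
    rows     : All (Linked _<_) T
    columns  : Linked (λ r s → Prefix _>_ s r) T
    distinct : Unique (concat T)
    positive : All (0 <_) (concat T)

-- The new row, together with the bumped entry (if any).
insertRow : ℕ → List ℕ → List ℕ × Maybe ℕ
insertRow x [] = [ x ] , nothing
insertRow x (y ∷ r) with x <? y
... | yes _ = x ∷ r , just y
... | no  _ = y ∷ proj₁ (insertRow x r) , proj₂ (insertRow x r)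

insert : ℕ → Tableau → Tableau
insert x [] = [ x ] ∷ []
insert x (r ∷ T) with insertRow x r
... | r′ , nothing = r′ ∷ T
... | r′ , just y  = r′ ∷ insert y T

-- Adds k T T′: T′ is T with the entry k put in one additional square.
data Adds (k : ℕ) : Tableau → Tableau → Set where
  new  : Adds k [] ([ k ] ∷ [])
  here : ∀ {r T} → Adds k (r ∷ T) ((r ∷ʳ k) ∷ T)
  down : ∀ {r T T′} → Adds k T T′ → Adds k (r ∷ T) (r ∷ T′)

------------------------------------------------------------------------
-- From vacillating tableaux to set partitions

-- The passage from T = T₂ₖ₋₂ to T₂ₖ₋₁, whose shape is to be μ; the last
-- index lists the recorded arc, if any.
data OddStep (k : ℕ) (T : Tableau) (μ : Shape) : Tableau → List Arc → Set where
  keep   : shape T ≡ μ → OddStep k T μ T []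
  delete : ∀ {T′ j} → IsStandard T′ → shape T′ ≡ μ → insert j T′ ≡ T →
           OddStep k T μ T′ [ j , k ]

-- The passage from T = T₂ₖ₋₁ to T₂ₖ, whose shape is to be ν.
data EvenStep (k : ℕ) (T : Tableau) (ν : Shape) : Tableau → Set where
  keep : shape T ≡ ν → EvenStep k T ν T
  add  : ∀ {T′} → Adds k T T′ → shape T′ ≡ ν → EvenStep k T ν T′

-- Records k T κs as: starting from T = T₂ₖ₋₂, with κs the remaining shapes
-- λ²ᵏ⁻¹, λ²ᵏ, …, the procedure runs to its end and records the arcs as.
data Records : ∀ {l} → ℕ → Tableau → Vec Shape (l * 2) → List Arc → Set where
  done : ∀ {k T} → Records {0} k T [] []
  step : ∀ {l k T T′ T″ μ ν as bs} {κs : Vec Shape (l * 2)} →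
         OddStep k T μ T′ as →
         EvenStep k T′ ν T″ →
         Records {l} (suc k) T″ κs bs →
         Records {suc l} k T (μ ∷ ν ∷ κs) (as ++ bs)

Corresponds : ∀ {m} → VacillatingTableau m → SetPartition m → Set
Corresponds {m} V R = ∃[ as ] Records {m} 1 [] (Vec.tail (shapes V)) as × as ↭ standardRep R

------------------------------------------------------------------------
-- The shapes attached to a pair of paths

row : ℕ → Shape
row zero    = []
row (suc r) = [ suc r ]

-- The row lengths of λ²ⁱ, λ²ⁱ⁺¹, …, λ⁴ⁿ⁺², where r is that of λ²ⁱ⁻¹ and the
-- arguments are the remaining steps pᵢ, … and qᵢ, … .  In the (D , U) case
-- r is positive whenever the pair is noncrossing.
lengths : ∀ {l} → ℕ → Vec Step l → Vec Step l → Vec ℕ (suc (l * 2))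
lengths r []      []      = 0 ∷ []
lengths r (U ∷ p) (U ∷ q) = suc r ∷ r ∷ lengths r p q
lengths r (U ∷ p) (D ∷ q) = suc r ∷ suc r ∷ lengths (suc r) p q
lengths r (D ∷ p) (U ∷ q) = r ∷ pred r ∷ lengths (pred r) p q
lengths r (D ∷ p) (D ∷ q) = r ∷ r ∷ lengths r p q

zetaShapes : ∀ {n} → NoncrossingPair n → Vec Shape (suc ((1 + 2 * n) * 2))
zetaShapes X = Vec.map row (0 ∷ 0 ∷ lengths 0 (steps (upper X)) (steps (lower X)))

------------------------------------------------------------------------
-- These shapes form a vacillating tableau

module ZetaWalk where

  data Down : ℕ → ℕ → Set where
    stay : ∀ {r} → Down r r
    drop : ∀ {r} → Down (suc r) r

  data Up : ℕ → ℕ → Set where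
    stay : ∀ {r} → Up r r
    lift : ∀ {r} → Up r (suc r)

  -- Vacillating sequences of one-row shapes, in terms of row lengths.
  data Walk : ∀ {m} → ℕ → Vec ℕ (m * 2) → Set where
    []   : Walk {0} 0 []
    step : ∀ {m r s t} {v : Vec ℕ (m * 2)} →
           Down r s → Up s t → Walk {m} t v → Walk {suc m} r (s ∷ t ∷ v)

  -- A remaining pair of path segments whose initial points are 2r apart.
  Above : ∀ {l} → ℕ → Vec Step l → Vec Step l → Set
  Above r p q = ∀ x → height q x ℤ.≤ height p x ℤ.+ (+ r ℤ.+ + r)

  Meet : ∀ {l} → ℕ → Vec Step l → Vec Step l → Set
  Meet {l} r p q = height q (fromℕ l) ≡ height p (fromℕ l) ℤ.+ (+ r ℤ.+ + r)

  cancel-≤ : ∀ c {a b a′ b′} → a′ ≡ c ℤ.+ a → b′ ≡ c ℤ.+ b → a′ ℤ.≤ b′ → a ℤ.≤ b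
  cancel-≤ c {a} {b} refl refl le = subst₂ ℤ._≤_ (lem c a) (lem c b) (ℤ.+-monoʳ-≤ (ℤ.- c) le)
    where
    lem : ∀ c a → ℤ.- c ℤ.+ (c ℤ.+ a) ≡ a
    lem = solve-∀

  cancel-≡ : ∀ c {a b a′ b′} → a′ ≡ c ℤ.+ a → b′ ≡ c ℤ.+ b → a′ ≡ b′ → a ≡ b
  cancel-≡ c {a} {b} refl refl e =
    ℤ.≤-antisym (cancel-≤ c refl refl (ℤ.≤-reflexive e)) (cancel-≤ c refl refl (ℤ.≤-reflexive (sym e)))

  +-suc² : ∀ r → (+ suc r) ℤ.+ (+ suc r) ≡ 1ℤ ℤ.+ (1ℤ ℤ.+ (+ r ℤ.+ + r))
  +-suc² r = cong (λ z → + suc z) (ℕ.+-suc r r)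

  same : ∀ c h d → (c ℤ.+ h) ℤ.+ d ≡ c ℤ.+ (h ℤ.+ d)
  same = solve-∀

  widen : ∀ r h → (1ℤ ℤ.+ h) ℤ.+ (+ r ℤ.+ + r) ≡ -1ℤ ℤ.+ (h ℤ.+ (+ suc r ℤ.+ + suc r))
  widen r h rewrite +-suc² r = lem h (+ r ℤ.+ + r)
    where
    lem : ∀ h d → (1ℤ ℤ.+ h) ℤ.+ d ≡ -1ℤ ℤ.+ (h ℤ.+ (1ℤ ℤ.+ (1ℤ ℤ.+ d)))
    lem = solve-∀

  narrow : ∀ r h → (-1ℤ ℤ.+ h) ℤ.+ (+ suc r ℤ.+ + suc r) ≡ 1ℤ ℤ.+ (h ℤ.+ (+ r ℤ.+ + r))
  narrow r h rewrite +-suc² r = lem h (+ r ℤ.+ + r)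
    where
    lem : ∀ h d → (-1ℤ ℤ.+ h) ℤ.+ (1ℤ ℤ.+ (1ℤ ℤ.+ d)) ≡ 1ℤ ℤ.+ (h ℤ.+ d)
    lem = solve-∀

  walk : ∀ {l r₀} r (p q : Vec Step l) → Above r p q → Meet r p q → Down r₀ r →
         Walk {suc l} r₀ (r ∷ lengths r p q)
  walk zero    []      []      ab me d = step d stay []
  walk (suc r) []      []      ab () d
  walk r (U ∷ p) (U ∷ q) ab me d = step d lift (walk r p q
    (λ x → cancel-≤ 1ℤ refl (same 1ℤ (height p x) _) (ab (suc x)))
    (cancel-≡ 1ℤ refl (same 1ℤ (height p (fromℕ _)) _) me) drop)
  walk r (U ∷ p) (D ∷ q) ab me d = step d lift (walk (suc r) p q
    (λ x → cancel-≤ -1ℤ refl (widen r (height p x)) (ab (suc x)))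
    (cancel-≡ -1ℤ refl (widen r (height p (fromℕ _))) me) stay)
  walk zero (D ∷ p) (U ∷ q) ab me d with () ← ab (suc zero)
  walk (suc r) (D ∷ p) (U ∷ q) ab me d = step d stay (walk r p q
    (λ x → cancel-≤ 1ℤ refl (narrow r (height p x)) (ab (suc x)))
    (cancel-≡ 1ℤ refl (narrow r (height p (fromℕ _))) me) drop)
  walk r (D ∷ p) (D ∷ q) ab me d = step d stay (walk r p q
    (λ x → cancel-≤ -1ℤ refl (same -1ℤ (height p x) _) (ab (suc x)))
    (cancel-≡ -1ℤ refl (same -1ℤ (height p (fromℕ _)) _) me) stay)

  zetaWalk : ∀ {n} (X : NoncrossingPair n) →
             Walk {1 + 2 * n} 0 (0 ∷ lengths 0 (steps (upper X)) (steps (lower X)))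
  zetaWalk X = walk 0 (steps (upper X)) (steps (lower X))
    (λ x → subst (height (steps (lower X)) x ℤ.≤_) (sym (ℤ.+-identityʳ _)) (noncrossing X x))
    (≡-trans (returns (lower X))
      (sym (≡-trans (ℤ.+-identityʳ _) (returns (upper X)))))
    stay

  row-partition : ∀ r → IsPartition (row r)
  row-partition zero    = [] , []
  row-partition (suc r) = [-] , (s≤s z≤n ∷ [])

  row-⋖ : ∀ r → row r ⋖ row (suc r)
  row-⋖ zero    = new
  row-⋖ (suc r) = here

  rows-partition : ∀ {l} (v : Vec ℕ l) → VecAll.All IsPartition (Vec.map row v)
  rows-partition []      = []
  rows-partition (r ∷ v) = row-partition r ∷ rows-partition v

  rows-vacillate : ∀ {m r} {v : Vec ℕ (m * 2)} → Walk {m} r v →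
                   Vacillates {m} (row r ∷ Vec.map row v)
  rows-vacillate []           = end
  rows-vacillate (step d u w) = step (odd d) (even u) (rows-vacillate w)
    where
    odd : ∀ {r s} → Down r s → row s ≡ row r ⊎ row s ⋖ row r
    odd stay = inj₁ refl
    odd drop = inj₂ (row-⋖ _)
    even : ∀ {s t} → Up s t → row t ≡ row s ⊎ row s ⋖ row t
    even stay = inj₁ refl
    even lift = inj₂ (row-⋖ _)

open ZetaWalk

zetaTableau : ∀ {n} → NoncrossingPair n → VacillatingTableau (1 + 2 * n)
zetaTableau X = record
  { shapes     = zetaShapes X
  ; partitions = rows-partition (0 ∷ 0 ∷ lengths 0 (steps (upper X)) (steps (lower X)))
  ; starts     = refl
  ; vacillates = rows-vacillate (zetaWalk X)
  }

------------------------------------------------------------------------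
-- The procedure succeeds on this vacillating tableau

module ZetaRecords where

  -- An open block, without its last element, and that element.
  Open : Set
  Open = List ℕ × ℕ

  block : Open → List ℕ
  block (b , j) = b ∷ʳ j

  -- The last elements of the open blocks are the entries of the tableau.
  contents : List Open → List ℕ
  contents []             = []
  contents ((b , j) ∷ os) = contents os ∷ʳ j

  data Sound : ℕ → List Open → Set where
    []  : ∀ {k} → Sound k []
    add : ∀ {k b j os} → 0 < j → j < k → Linked _<_ (b ∷ʳ j) → Sound j os → Sound k ((b , j) ∷ os)

  weaken : ∀ {j k os} → j ≤ k → Sound j os → Sound k os
  weaken j≤k []               = []
  weaken j≤k (add 0<i i<j b s) = add 0<i (ℕ.<-≤-trans i<j j≤k) b s

  tab : List ℕ → Tableau
  tab []      = []
  tab (x ∷ c) = (x ∷ c) ∷ []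

  shape-tab : ∀ c → shape (tab c) ≡ row (length c)
  shape-tab []      = refl
  shape-tab (x ∷ c) = refl

  length-contents : ∀ os → length (contents os) ≡ length os
  length-contents []             = refl
  length-contents ((b , j) ∷ os) = ≡-trans (List.length-++ (contents os))
    (≡-trans (ℕ.+-comm _ 1) (cong suc (length-contents os)))

  shape-contents : ∀ os → shape (tab (contents os)) ≡ row (length os)
  shape-contents os = ≡-trans (shape-tab (contents os)) (cong row (length-contents os))

  Linked-∷ʳ : ∀ {c k} → Linked _<_ c → All (_< k) c → Linked _<_ (c ∷ʳ k)
  Linked-∷ʳ []       []          = [-]
  Linked-∷ʳ [-]      (x<k ∷ [])  = x<k ∷ [-]
  Linked-∷ʳ (lt ∷ l) (_ ∷ bound) = lt ∷ Linked-∷ʳ l bound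

  Linked-∷ʳ² : ∀ b {j k} → Linked _<_ (b ∷ʳ j) → j < k → Linked _<_ ((b ∷ʳ j) ∷ʳ k)
  Linked-∷ʳ² []          _        j<k = j<k ∷ [-]
  Linked-∷ʳ² (x ∷ [])    (lt ∷ l) j<k = lt ∷ Linked-∷ʳ² [] l j<k
  Linked-∷ʳ² (x ∷ y ∷ b) (lt ∷ l) j<k = lt ∷ Linked-∷ʳ² (y ∷ b) l j<k

  contents-< : ∀ {k os} → Sound k os → All (_< k) (contents os)
  contents-< []              = []
  contents-< (add _ j<k _ s) = All.∷ʳ⁺ (All.map (λ i<j → ℕ.<-trans i<j j<k) (contents-< s)) j<k

  contents-positive : ∀ {k os} → Sound k os → All (0 <_) (contents os)
  contents-positive []              = []
  contents-positive (add 0<j _ _ s) = All.∷ʳ⁺ (contents-positive s) 0<j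

  contents-increasing : ∀ {k os} → Sound k os → Linked _<_ (contents os)
  contents-increasing []            = []
  contents-increasing (add _ _ _ s) = Linked-∷ʳ (contents-increasing s) (contents-< s)

  concat-tab : ∀ c → concat (tab c) ≡ c
  concat-tab []      = refl
  concat-tab (x ∷ c) = List.++-identityʳ (x ∷ c)

  tab-standard : ∀ c → Linked _<_ c → All (0 <_) c → IsStandard (tab c)
  tab-standard c l pos = record
    { diagram  = subst IsPartition (sym (shape-tab c)) (row-partition (length c))
    ; rows     = rows′ c l
    ; columns  = columns′ c
    ; distinct = subst Unique (sym (concat-tab c))
                   (AllPairs.map ℕ.<⇒≢ (Linked⇒AllPairs ℕ.<-trans l))
    ; positive = subst (All (0 <_)) (sym (concat-tab c)) pos
    }
    where
    rows′ : ∀ c → Linked _<_ c → All (Linked _<_) (tab c)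
    rows′ []      _ = []
    rows′ (x ∷ c) l = l ∷ []
    columns′ : ∀ c → Linked (λ r s → Prefix _>_ s r) (tab c)
    columns′ []      = []
    columns′ (x ∷ c) = [-]

  insertRow-max : ∀ {j} c → All (_< j) c → insertRow j c ≡ (c ∷ʳ j , nothing)
  insertRow-max []      []       = refl
  insertRow-max {j} (x ∷ c) (x<j ∷ lt) with j <? x
  ... | yes j<x = contradiction j<x (ℕ.<-asym x<j)
  ... | no  _ rewrite insertRow-max c lt = refl

  insert-max : ∀ {j} c → All (_< j) c → insert j (tab c) ≡ tab (c ∷ʳ j)
  insert-max []      _  = refl
  insert-max (x ∷ c) lt rewrite insertRow-max (x ∷ c) lt = refl

  adds : ∀ k c → Adds k (tab c) (tab (c ∷ʳ k))
  adds k []      = new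
  adds k (x ∷ c) = here

  blockArcs-∷ʳ² : ∀ b j k → blockArcs ((b ∷ʳ j) ∷ʳ k) ≡ blockArcs (b ∷ʳ j) ∷ʳ (j , k)
  blockArcs-∷ʳ² []          j k = refl
  blockArcs-∷ʳ² (x ∷ [])    j k = refl
  blockArcs-∷ʳ² (x ∷ y ∷ b) j k = cong ((x , y) ∷_) (blockArcs-∷ʳ² (y ∷ b) j k)

  ∷ʳ≢[] : ∀ (b : List ℕ) {j} → b ∷ʳ j ≢ []
  ∷ʳ≢[] []      ()
  ∷ʳ≢[] (x ∷ b) ()

  concat-↭ : ∀ {A : Set} {xs ys : List (List A)} → xs ↭ ys → concat xs ↭ concat ys
  concat-↭ refl          = ↭-refl
  concat-↭ (prep x p)    = Perm.++⁺ˡ x (concat-↭ p)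
  concat-↭ (swap x y p)  = ↭-trans (Perm.shifts x y) (Perm.++⁺ˡ y (Perm.++⁺ˡ x (concat-↭ p)))
  concat-↭ (trans p₁ p₂) = ↭-trans (concat-↭ p₁) (concat-↭ p₂)

  arcsOf : List (List ℕ) → List Arc
  arcsOf = concatMap blockArcs

  arcsOf-↭ : ∀ {xs ys} → xs ↭ ys → arcsOf xs ↭ arcsOf ys
  arcsOf-↭ p = concat-↭ (Perm.map⁺ blockArcs p)

  snoc-front : ∀ {A : Set} (b : List A) j c → (b ∷ʳ j) ++ c ↭ (b ++ c) ∷ʳ j
  snoc-front b j c = begin
    (b ++ [ j ]) ++ c  ≡⟨ List.++-assoc b [ j ] c ⟩
    b ++ j ∷ c         ↭⟨ Perm.++⁺ˡ b (Perm.∷↭∷ʳ j c) ⟩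
    b ++ (c ∷ʳ j)      ≡⟨ List.++-assoc b c [ j ] ⟨
    (b ++ c) ∷ʳ j      ∎
    where open PermutationReasoning

  -- All blocks met so far.
  all : List Open → List (List ℕ) → List (List ℕ)
  all os closed = map block os ++ closed

  record State (K : ℕ) (os : List Open) (closed : List (List ℕ)) : Set where
    field
      sound : Sound (suc K) os
      full  : All (_≢ []) closed
      incr  : All (Linked _<_) closed
      cover : concat (all os closed) ↭ applyUpTo suc K

  start : State 0 [] []
  start = record { sound = [] ; full = [] ; incr = [] ; cover = ↭-refl }

  -- The situation between the two steps for the element suc K, whose block
  -- is b ∷ʳ suc K.
  record Middle (K : ℕ) (b : List ℕ) (os : List Open) (closed : List (List ℕ)) : Set where
    field
      sound : Sound (suc K) os
      full  : All (_≢ []) closed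
      incr  : All (Linked _<_) closed
      this  : Linked _<_ (b ∷ʳ suc K)
      cover : concat ((b ∷ʳ suc K) ∷ all os closed) ↭ applyUpTo suc (suc K)

  odd : ∀ {K r s os closed} → Down r s → length os ≡ r → State K os closed →
        ∃[ b ] ∃[ os′ ] ∃[ as ]
          Middle K b os′ closed × length os′ ≡ s ×
          OddStep (suc K) (tab (contents os)) (row s) (tab (contents os′)) as ×
          arcsOf ((b ∷ʳ suc K) ∷ all os′ closed) ↭ arcsOf (all os closed) ++ as
  odd {K} {os = os} {closed} stay refl st = [] , os , [] , mid , refl , keep (shape-contents os) ,
    ↭-reflexive (sym (List.++-identityʳ _))
    where
    open State st
    mid : Middle K [] os closed
    mid = record
      { sound = sound ; full = full ; incr = incr ; this = [-]
      ; cover = ↭-trans (Perm.∷↭∷ʳ (suc K) _)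
                  (↭-trans (Perm.++⁺ʳ [ suc K ] cover) (↭-reflexive (List.applyUpTo-∷ʳ suc K)))
      }
  odd {K} {os = (b , j) ∷ os} {closed} drop refl st with State.sound st
  ... | add 0<j j<k lb so =
    b ∷ʳ j , os , [ j , suc K ] , mid , refl ,
    delete (tab-standard (contents os) (contents-increasing so) (contents-positive so))
           (shape-contents os) (insert-max (contents os) (contents-< so)) ,
    ↭-trans (↭-reflexive (cong (_++ arcsOf (all os closed)) (blockArcs-∷ʳ² b j (suc K))))
            (snoc-front (blockArcs (b ∷ʳ j)) (j , suc K) (arcsOf (all os closed)))
    where
    open State st
    mid : Middle K (b ∷ʳ j) os closed
    mid = record
      { sound = weaken (ℕ.<⇒≤ j<k) so ; full = full ; incr = incr
      ; this  = Linked-∷ʳ² b lb j<k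
      ; cover = ↭-trans (snoc-front (b ∷ʳ j) (suc K) (concat (all os closed)))
                  (↭-trans (Perm.++⁺ʳ [ suc K ] cover) (↭-reflexive (List.applyUpTo-∷ʳ suc K)))
      }

  even : ∀ {K s t b os closed} → length os ≡ s → Up s t → Middle K b os closed →
         ∃[ os′ ] ∃[ closed′ ]
           State (suc K) os′ closed′ × length os′ ≡ t ×
           EvenStep (suc K) (tab (contents os)) (row t) (tab (contents os′)) ×
           arcsOf (all os′ closed′) ↭ arcsOf ((b ∷ʳ suc K) ∷ all os closed)
  even {K} {b = b} {os} {closed} refl stay mid =
    os , (b ∷ʳ suc K) ∷ closed , st , refl , keep (shape-contents os) , arcsOf-↭ moved
    where
    open Middle mid
    moved : all os ((b ∷ʳ suc K) ∷ closed) ↭ (b ∷ʳ suc K) ∷ all os closed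
    moved = Perm.shift (b ∷ʳ suc K) (map block os) closed
    st : State (suc K) os ((b ∷ʳ suc K) ∷ closed)
    st = record
      { sound = weaken (ℕ.n≤1+n _) sound ; full = ∷ʳ≢[] b ∷ full ; incr = this ∷ incr
      ; cover = ↭-trans (concat-↭ moved) cover
      }
  even {K} {b = b} {os} {closed} refl lift mid =
    (b , suc K) ∷ os , closed , st , refl ,
    add (adds (suc K) (contents os)) (shape-contents ((b , suc K) ∷ os)) , ↭-refl
    where
    open Middle mid
    st : State (suc K) ((b , suc K) ∷ os) closed
    st = record
      { sound = add (s≤s z≤n) ℕ.≤-refl this sound ; full = full ; incr = incr ; cover = cover }

  run : ∀ {l m} K {r os closed} {v : Vec ℕ (l * 2)} → K + l ≡ m → length os ≡ r →
        Walk {l} r v → State K os closed →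
        ∃[ R ] ∃[ as ]
          Records {l} (suc K) (tab (contents os)) (Vec.map row v) as ×
          arcsOf (all os closed) ++ as ↭ standardRep {m} R
  run K {os = []} {closed} refl refl [] st =
    R , [] , done , ↭-reflexive (List.++-identityʳ _)
    where
    open State st
    R : SetPartition (K + 0)
    R = record
      { blocks = closed ; nonempty = full ; increasing = incr
      ; covers = subst (λ z → concat closed ↭ applyUpTo suc z) (sym (ℕ.+-identityʳ K)) cover
      }
  run {l = suc l} {m} K {os = os} {closed} len refl (step d u w) st
    with b , os₁ , as , mid , refl , odd-ok , arcs₁ ← odd d refl st
    with os₂ , closed₂ , st₂ , refl , even-ok , arcs₂ ← even refl u mid
    with R , bs , rec , arcs ← run (suc K) (≡-trans (sym (ℕ.+-suc K l)) len) refl w st₂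
    = R , as ++ bs , step odd-ok even-ok rec , (begin
      arcsOf (all os closed) ++ as ++ bs                ≡⟨ List.++-assoc (arcsOf (all os closed)) as bs ⟨
      (arcsOf (all os closed) ++ as) ++ bs              ↭⟨ Perm.++⁺ʳ bs arcs₁ ⟨
      arcsOf ((b ∷ʳ suc K) ∷ all os₁ closed) ++ bs      ↭⟨ Perm.++⁺ʳ bs arcs₂ ⟨
      arcsOf (all os₂ closed₂) ++ bs                    ↭⟨ arcs ⟩
      standardRep R                                     ∎)
    where open PermutationReasoning

open ZetaRecords using (run; start)

ζ-exists : ∀ {n} (X : NoncrossingPair n) → ∃[ R ] Corresponds (zetaTableau X) R
ζ-exists X = run 0 refl refl (zetaWalk X) start

-- Corresponds determines the partition: a deletion from a standard tableau
-- can be undone in one way only, and the arcs of a partition determine its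
-- blocks, so ζ is the map given by the procedure.
ζ : ∀ {n} → NoncrossingPair n → SetPartition (1 + 2 * n)
ζ X = proj₁ (ζ-exists X)

ζ-corresponds : ∀ {n} (X : NoncrossingPair n) → Corresponds (zetaTableau X) (ζ X)
ζ-corresponds X = proj₂ (ζ-exists X)

{-# OPTIONS --safe #-}

-- The tableaux met by ζ have one row, so the entry removed is always the
-- largest one, and the procedure keeps a stack of open blocks: pᵢ decides
-- whether the block of i stays open, and qᵢ whether i + 1 joins the latest
-- open block or begins a new one.  Hence there are 1 + #{i : qᵢ = D} = n + 1
-- blocks.  The stack discipline makes the partition noncrossing; conversely,
-- in a noncrossing partition i + 1 can only continue the latest block that
-- is still open.  The steps are read off the partition: pᵢ = D iff i is the
-- maximum of its block, and qᵢ = D iff i + 1 is the minimum of its block.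
module Submission where

open import Defs
open ZetaWalk
open ZetaRecords
open import Data.Nat using (ℕ; zero; suc; _+_; _*_; _<_; _≤_; _>_; s≤s; z≤n; s≤s⁻¹; NonZero)
import Data.Nat.Properties as ℕ
open import Data.Integer as ℤ using (ℤ; 0ℤ; 1ℤ; -1ℤ; +_; +≤+)
import Data.Integer.Properties as ℤ
open import Data.Integer.Tactic.RingSolver using (solve-∀)
open import Data.Fin using (zero; suc; fromℕ)
open import Data.Vec using (Vec; []; _∷_; head)
open import Data.List using (List; []; _∷_; _++_; _∷ʳ_; length; map; concat; applyUpTo; initLast; _∷ʳ′_)
import Data.List.Properties as List
open import Data.List.Membership.Propositional using (_∈_)
open import Data.List.Membership.Propositional.Properties
open import Data.List.Relation.Unary.All as All using (All; []; _∷_)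
open import Data.List.Relation.Unary.AllPairs using ([]; _∷_)
open import Data.List.Relation.Unary.Any using (here; there)
open import Data.List.Relation.Unary.Linked as Linked using (Linked; [-]; _∷_)
open import Data.List.Relation.Unary.Linked.Properties using (Linked⇒All)
open import Data.List.Relation.Unary.Unique.Propositional using (Unique)
import Data.List.Relation.Unary.Unique.Propositional.Properties as Unique
open import Data.List.Relation.Binary.Permutation.Propositional
  using (_↭_; ↭-refl; ↭-sym; ↭-trans; ↭-reflexive; prep; ↭⇒↭ₛ; module PermutationReasoning)
import Data.List.Relation.Binary.Permutation.Propositional.Properties as Perm
import Data.List.Relation.Binary.Permutation.Setoid.Properties as PermSetoid
open import Data.Product using (Σ-syntax; ∃-syntax; _×_; _,_; proj₁; proj₂)
open import Data.Sum using (inj₁; inj₂)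
open import Function using (_∘_)
open import Function.Definitions using (Bijective)
open import Relation.Nullary using (¬_; contradiction)
open import Relation.Binary.PropositionalEquality

-- The procedure as a relation on the two step sequences.

-- Run K b os cl p q B: when the element suc K joins the block b (empty if
-- suc K is a minimum) while the blocks os are open, latest first, and cl are
-- closed, the remaining steps p and q lead to the blocks B.
data Run : ∀ {l} → ℕ → List ℕ → List Open → List (List ℕ) →
           Vec Step l → Vec Step l → List (List ℕ) → Set where
  end : ∀ {K b cl} → Run K b [] cl [] [] ((b ∷ʳ suc K) ∷ cl)
  uu  : ∀ {l K b os cl B} {p q : Vec Step l} →
        Run (suc K) (b ∷ʳ suc K) os cl p q B → Run K b os cl (U ∷ p) (U ∷ q) B
  ud  : ∀ {l K b os cl B} {p q : Vec Step l} →
        Run (suc K) [] ((b , suc K) ∷ os) cl p q B → Run K b os cl (U ∷ p) (D ∷ q) B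
  du  : ∀ {l K b b′ j os cl B} {p q : Vec Step l} →
        Run (suc K) (b′ ∷ʳ j) os ((b ∷ʳ suc K) ∷ cl) p q B →
        Run K b ((b′ , j) ∷ os) cl (D ∷ p) (U ∷ q) B
  dd  : ∀ {l K b os cl B} {p q : Vec Step l} →
        Run (suc K) [] os ((b ∷ʳ suc K) ∷ cl) p q B → Run K b os cl (D ∷ p) (D ∷ q) B

blocks-run-[] : ∀ {m} K {cl} (len : K + 0 ≡ m) (st : State K [] cl) →
                blocks (proj₁ (run K len refl [] st)) ≡ cl
blocks-run-[] K refl st = refl

-- `run` adds arcs to the result of its recursive call and passes the partition on unchanged.
blocks-run-step : ∀ {l m} K {r s t os cl} {v : Vec ℕ (l * 2)} (len : K + suc l ≡ m)
  (e : length os ≡ r) (d : Down r s) (u : Up s t) (w : Walk {l} t v) (st : State K os cl) →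
  let b , os₁ , as , mid , e₁ , _ = odd d e st
      os₂ , cl₂ , st₂ , e₂ , _    = even e₁ u mid
  in blocks (proj₁ (run K len e (step d u w) st))
       ≡ blocks (proj₁ (run (suc K) (trans (sym (ℕ.+-suc K l)) len) e₂ w st₂))
-- The first clause of `run` asks for an empty stack, so `run` unfolds only once `os` is split; both
-- cases are then alike.
blocks-run-step K {os = []} refl refl d u w st with odd d refl st
... | b , os₁ , as , mid , refl , _ with even refl u mid
... | os₂ , cl₂ , st₂ , refl , _ = refl
blocks-run-step K {os = _ ∷ _} refl refl d u w st with odd d refl st
... | b , os₁ , as , mid , refl , _ with even refl u mid
... | os₂ , cl₂ , st₂ , refl , _ = refl

-- walk splits on the row length first, hence does not unfold on the steps alone;
-- its remaining arguments do not matter.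
walk-uu : ∀ {l r₀} r (p q : Vec Step l) ab me (d : Down r₀ r) → ∃[ ab′ ] ∃[ me′ ]
          walk r (U ∷ p) (U ∷ q) ab me d ≡ step d lift (walk r p q ab′ me′ drop)
walk-uu zero    p q ab me d = _ , _ , refl
walk-uu (suc r) p q ab me d = _ , _ , refl

walk-ud : ∀ {l r₀} r (p q : Vec Step l) ab me (d : Down r₀ r) → ∃[ ab′ ] ∃[ me′ ]
          walk r (U ∷ p) (D ∷ q) ab me d ≡ step d lift (walk (suc r) p q ab′ me′ stay)
walk-ud zero    p q ab me d = _ , _ , refl
walk-ud (suc r) p q ab me d = _ , _ , refl

walk-du : ∀ {l r₀} r (p q : Vec Step l) ab me (d : Down r₀ (suc r)) → ∃[ ab′ ] ∃[ me′ ]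
          walk (suc r) (D ∷ p) (U ∷ q) ab me d ≡ step d stay (walk r p q ab′ me′ drop)
walk-du r p q ab me d = _ , _ , refl

walk-dd : ∀ {l r₀} r (p q : Vec Step l) ab me (d : Down r₀ r) → ∃[ ab′ ] ∃[ me′ ]
          walk r (D ∷ p) (D ∷ q) ab me d ≡ step d stay (walk r p q ab′ me′ stay)
walk-dd zero    p q ab me d = _ , _ , refl
walk-dd (suc r) p q ab me d = _ , _ , refl

-- `pᵢ` governs the even step of element `i` and `qᵢ` the odd step of `i + 1`, so a `Run` begins
-- halfway through an element. This is why its block and stack are those returned by `odd`.
run-Run : ∀ {l m} K {r₀ r os cl} (p q : Vec Step l) (ab : Above r p q) (me : Meet r p q)
          (d : Down r₀ r) (len : K + suc l ≡ m) (e : length os ≡ r₀) (st : State K os cl) →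
          Run K (proj₁ (odd d e st)) (proj₁ (proj₂ (odd d e st))) cl p q
            (blocks (proj₁ (run K len e (walk r p q ab me d) st)))
run-Run K {r = zero} [] [] ab me d len e st
  rewrite blocks-run-step K len e d stay [] st with odd d e st
... | b , [] , as , mid , refl , _
  rewrite blocks-run-[] (suc K) (trans (sym (ℕ.+-suc K 0)) len)
            (proj₁ (proj₂ (proj₂ (even refl stay mid)))) = end
run-Run K {r = suc r} [] [] ab () d len e st
run-Run K {r = r} (U ∷ p) (U ∷ q) ab me d len e st
  with ab′ , me′ , eq ← walk-uu r p q ab me d
  rewrite eq | blocks-run-step K len e d lift (walk r p q ab′ me′ drop) st with odd d e st
... | b , os , as , mid , refl , _ = uu (run-Run (suc K) p q ab′ me′ drop _ refl _)
run-Run K {r = r} (U ∷ p) (D ∷ q) ab me d len e st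
  with ab′ , me′ , eq ← walk-ud r p q ab me d
  rewrite eq | blocks-run-step K len e d lift (walk (suc r) p q ab′ me′ stay) st with odd d e st
... | b , os , as , mid , refl , _ = ud (run-Run (suc K) p q ab′ me′ stay _ refl _)
run-Run K {r = zero} (D ∷ p) (U ∷ q) ab me d len e st with () ← ab (suc zero)
run-Run K {r = suc r} (D ∷ p) (U ∷ q) ab me d len e st
  with ab′ , me′ , eq ← walk-du r p q ab me d
  rewrite eq | blocks-run-step K len e d stay (walk r p q ab′ me′ drop) st with odd d e st
-- The soundness evidence is matched because the next `odd drop` computes only when it is an `add`.
... | b , (b′ , j) ∷ os , as , record { sound = add 0<j j<k lb so } , refl , _ =
  du (run-Run (suc K) p q ab′ me′ drop _ refl _)
run-Run K {r = r} (D ∷ p) (D ∷ q) ab me d len e st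
  with ab′ , me′ , eq ← walk-dd r p q ab me d
  rewrite eq | blocks-run-step K len e d stay (walk r p q ab′ me′ stay) st with odd d e st
... | b , os , as , mid , refl , _ = dd (run-Run (suc K) p q ab′ me′ stay _ refl _)

ζ-Run : ∀ {n} (X : NoncrossingPair n) →
        Run 0 [] [] [] (steps (upper X)) (steps (lower X)) (blocks (ζ X))
ζ-Run X = run-Run 0 (steps (upper X)) (steps (lower X)) _ _ stay refl refl start

-- Counting blocks, and the heights of the two paths.

downs : ∀ {l} → Vec Step l → ℕ
downs []      = 0
downs (U ∷ q) = downs q
downs (D ∷ q) = suc (downs q)

-- Crediting 2 to each down step makes every step count as a rise by 1.
height-downs : ∀ {l} (q : Vec Step l) → height q (fromℕ l) ℤ.+ + (downs q + downs q) ≡ + l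
height-downs []      = refl
height-downs (U ∷ q) = trans (ℤ.+-assoc 1ℤ (height q (fromℕ _)) _)
  (cong (ℤ._+_ 1ℤ) (height-downs q))
height-downs {suc l} (D ∷ q) = begin
  (-1ℤ ℤ.+ h) ℤ.+ + suc (downs q + suc (downs q)) ≡⟨ cong (λ z → (-1ℤ ℤ.+ h) ℤ.+ z) (+-suc² (downs q)) ⟩
  (-1ℤ ℤ.+ h) ℤ.+ (1ℤ ℤ.+ (1ℤ ℤ.+ + (downs q + downs q))) ≡⟨ rearrange h _ ⟩
  1ℤ ℤ.+ (h ℤ.+ + (downs q + downs q)) ≡⟨ cong (ℤ._+_ 1ℤ) (height-downs q) ⟩
  + suc l ∎
  where
  open ≡-Reasoning
  h = height q (fromℕ l)
  rearrange : ∀ h d → (-1ℤ ℤ.+ h) ℤ.+ (1ℤ ℤ.+ (1ℤ ℤ.+ d)) ≡ 1ℤ ℤ.+ (h ℤ.+ d)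
  rearrange = solve-∀

double-injective : ∀ {a b} → a + a ≡ b + b → a ≡ b
double-injective {zero}  {zero}  _  = refl
double-injective {suc a} {suc b} eq = cong suc (double-injective
  (ℕ.suc-injective (trans (sym (ℕ.+-suc a a)) (trans (ℕ.suc-injective eq) (ℕ.+-suc b b)))))

2*n≡n+n : ∀ n → 2 * n ≡ n + n
2*n≡n+n n = cong (λ z → n + z) (ℕ.+-identityʳ n)

returns⇒downs : ∀ n (q : Vec Step (2 * n)) → height q (fromℕ (2 * n)) ≡ 0ℤ → downs q ≡ n
returns⇒downs n q ret = double-injective (trans (ℤ.+-injective (trans (sym (ℤ.+-identityˡ _))
  (subst (λ h → h ℤ.+ + (downs q + downs q) ≡ + (2 * n)) ret (height-downs q)))) (2*n≡n+n n))

downs⇒returns : ∀ n (q : Vec Step (2 * n)) → downs q ≡ n → height q (fromℕ (2 * n)) ≡ 0ℤ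
downs⇒returns n q eq = cancel-≡ (+ (n + n)) (ℤ.+-comm h (+ (n + n))) (ℤ.+-comm 0ℤ (+ (n + n)))
  (trans (subst (λ d → h ℤ.+ + (d + d) ≡ + (2 * n)) eq (height-downs q)) (cong +_ (2*n≡n+n n)))
  where h = height q (fromℕ (2 * n))

-- Only a `D` in `q` creates a block; otherwise blocks are extended or move between current, open
-- and closed.
length-Run : ∀ {l K b os cl B} {p q : Vec Step l} → Run K b os cl p q B →
             length B ≡ suc (downs q + (length os + length cl))
length-Run end    = refl
length-Run (uu r) = length-Run r
length-Run {os = os} {cl} {q = D ∷ q} (ud r) =
  trans (length-Run r) (cong suc (ℕ.+-suc (downs q) (length os + length cl)))
length-Run {os = _ ∷ os} {cl} {q = U ∷ q} (du r) =
  trans (length-Run r) (cong (λ z → suc (downs q + z)) (ℕ.+-suc (length os) (length cl)))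
length-Run {os = os} {cl} {q = D ∷ q} (dd r) =
  trans (length-Run r) (cong suc (trans (cong (λ z → downs q + z) (ℕ.+-suc (length os) (length cl)))
    (ℕ.+-suc (downs q) (length os + length cl))))

-- The stack records half the distance between the paths: `ud` widens it by 2 and pushes, `du`
-- narrows it by 2 and pops. With `Run-Meet`, where the stack ends empty, this turns any run from
-- the initial situation into a noncrossing pair whose paths have a common endpoint.
Run-Above : ∀ {l K b os cl B} {p q : Vec Step l} → Run K b os cl p q B → Above (length os) p q
Run-Above r      zero    = +≤+ z≤n
Run-Above {p = _ ∷ p} (uu r) (suc x) = subst (ℤ._≤_ _) (sym (same 1ℤ (height p x) _))
  (ℤ.+-monoʳ-≤ 1ℤ (Run-Above r x))
Run-Above {p = _ ∷ p} (ud r) (suc x) = subst (ℤ._≤_ _) (sym (widen _ (height p x)))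
  (ℤ.+-monoʳ-≤ -1ℤ (Run-Above r x))
Run-Above {p = _ ∷ p} (du r) (suc x) = subst (ℤ._≤_ _) (sym (narrow _ (height p x)))
  (ℤ.+-monoʳ-≤ 1ℤ (Run-Above r x))
Run-Above {p = _ ∷ p} (dd r) (suc x) = subst (ℤ._≤_ _) (sym (same -1ℤ (height p x) _))
  (ℤ.+-monoʳ-≤ -1ℤ (Run-Above r x))

Run-Meet : ∀ {l K b os cl B} {p q : Vec Step l} → Run K b os cl p q B → Meet (length os) p q
Run-Meet end = refl
Run-Meet {p = _ ∷ p} (uu r) = trans (cong (ℤ._+_ 1ℤ) (Run-Meet r)) (sym (same 1ℤ (height p (fromℕ _)) _))
Run-Meet {p = _ ∷ p} (ud r) = trans (cong (ℤ._+_ -1ℤ) (Run-Meet r)) (sym (widen _ (height p (fromℕ _))))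
Run-Meet {p = _ ∷ p} (du r) = trans (cong (ℤ._+_ 1ℤ) (Run-Meet r)) (sym (narrow _ (height p (fromℕ _))))
Run-Meet {p = _ ∷ p} (dd r) = trans (cong (ℤ._+_ -1ℤ) (Run-Meet r)) (sym (same -1ℤ (height p (fromℕ _)) _))

-- Noncrossing

NoncrossingArcs : List Arc → Set
NoncrossingArcs A = ∀ i₁ j₁ i₂ j₂ → (i₁ , j₁) ∈ A → (i₂ , j₂) ∈ A → ¬ (i₁ < i₂ × i₂ < j₁ × j₁ < j₂)

-- A holds the arcs so far, all ending before k, and es the last elements of
-- the open blocks, latest first, all less than l.
record Nested (k l : ℕ) (A : List Arc) (es : List ℕ) : Set where
  field
    bounded    : ∀ {i j} → (i , j) ∈ A → j < k
    exposed    : ∀ {i j e} → (i , j) ∈ A → e ∈ es → ¬ (i < e × e < j)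
    descending : Linked _>_ (l ∷ es)
    disjoint   : NoncrossingArcs A

descending⇒All : ∀ {l es} → Linked _>_ (l ∷ es) → All (l >_) es
descending⇒All [-]        = []
descending⇒All (l>e ∷ es) = Linked⇒All (λ x>y y>z → ℕ.<-trans y>z x>y) l>e es

module _ {k : ℕ} {A : List Arc} {es : List ℕ} where

  -- `Nested-stay` and `Nested-drop` are the two kinds of odd step and raise the bound on arcs;
  -- `Nested-skip` and `Nested-push` are the two kinds of even step and raise the bound on open
  -- ends.
  Nested-stay : Nested k k A es → Nested (suc k) k A es
  Nested-stay N = record
    { bounded = ℕ.m<n⇒m<1+n ∘ bounded ; exposed = exposed ; descending = descending ; disjoint = disjoint }
    where open Nested N

  -- The top `e` exceeds all other open ends, so the new arc covers none of them. An earlier arc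
  -- cannot cross it: none covers `e`, as `e` was exposed, and none reaches beyond `k`.
  Nested-drop : ∀ {e} → Nested k k A (e ∷ es) → Nested (suc k) k ((e , k) ∷ A) es
  Nested-drop {e} N = record
    { bounded    = λ { (here refl) → ℕ.≤-refl ; (there a) → ℕ.m<n⇒m<1+n (bounded a) }
    ; exposed    = λ { (here refl) m (e<e′ , _) → ℕ.<-asym e<e′ 
                         (All.lookup (descending⇒All (Linked.tail descending)) m)
                     ; (there a) m → exposed a (there m) }
    ; descending = shorten descending
    ; disjoint   = λ { _ _ _ _ (here refl) (here refl) (e<e , _)   → ℕ.<-irrefl refl e<e
                     ; _ _ _ _ (here refl) (there a) (_ , _ , k<j) → ℕ.<-asym k<j (bounded a)
                     ; _ _ _ _ (there a) (here refl) (i<e , e<j , _) → exposed a (here refl) (i<e , e<j)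
                     ; _ _ _ _ (there a) (there a′) → disjoint _ _ _ _ a a′ }
    }
    where
    open Nested N
    shorten : ∀ {l e es} → Linked _>_ (l ∷ e ∷ es) → Linked _>_ (l ∷ es)
    shorten (_ ∷ [-])        = [-]
    shorten (l>e ∷ e>e′ ∷ d) = ℕ.<-trans e>e′ l>e ∷ d

  Nested-skip : Nested (suc k) k A es → Nested (suc k) (suc k) A es
  Nested-skip N = record
    { bounded = bounded ; exposed = exposed ; descending = raise descending ; disjoint = disjoint }
    where
    open Nested N
    raise : ∀ {l es} → Linked _>_ (l ∷ es) → Linked _>_ (suc l ∷ es)
    raise [-]       = [-]
    raise (l>e ∷ d) = ℕ.m<n⇒m<1+n l>e ∷ d

  -- No arc so far ends after `k`, so none covers the new top.
  Nested-push : Nested (suc k) k A es → Nested (suc k) (suc k) A (k ∷ es)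
  Nested-push N = record
    { bounded    = bounded
    ; exposed    = λ { a (here refl) (_ , k<j) → ℕ.<⇒≱ k<j (s≤s⁻¹ (bounded a))
                     ; a (there m) → exposed a m }
    ; descending = ℕ.≤-refl ∷ descending
    ; disjoint   = disjoint
    }
    where open Nested N

  Nested-resp-↭ : ∀ {l A′} → A′ ↭ A → Nested k l A es → Nested k l A′ es
  Nested-resp-↭ A′↭A N = record
    { bounded    = bounded ∘ Perm.∈-resp-↭ A′↭A
    ; exposed    = exposed ∘ Perm.∈-resp-↭ A′↭A
    ; descending = descending
    ; disjoint   = λ _ _ _ _ a a′ →
        disjoint _ _ _ _ (Perm.∈-resp-↭ A′↭A a) (Perm.∈-resp-↭ A′↭A a′)
    }
    where open Nested N

arcsOf-extend : ∀ b j k bs → arcsOf (((b ∷ʳ j) ∷ʳ k) ∷ bs) ↭ (j , k) ∷ arcsOf ((b ∷ʳ j) ∷ bs)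
arcsOf-extend b j k bs = begin
  blockArcs ((b ∷ʳ j) ∷ʳ k) ++ arcsOf bs        ≡⟨ cong (_++ arcsOf bs) (blockArcs-∷ʳ² b j k) ⟩
  (blockArcs (b ∷ʳ j) ∷ʳ (j , k)) ++ arcsOf bs  ≡⟨ List.∷ʳ-++ (blockArcs (b ∷ʳ j)) (j , k) (arcsOf bs) ⟩
  blockArcs (b ∷ʳ j) ++ (j , k) ∷ arcsOf bs     ↭⟨ Perm.shift (j , k) (blockArcs (b ∷ʳ j)) (arcsOf bs) ⟩
  (j , k) ∷ blockArcs (b ∷ʳ j) ++ arcsOf bs     ∎
  where open PermutationReasoning

-- The hypothesis holds midway through `suc K`: arcs may end at `suc K`, but the open blocks end
-- earlier. Each constructor is an even step followed by the odd step of the next element, hence two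
-- transitions of `Nested`.
Run-noncrossing : ∀ {l K b os cl B} {p q : Vec Step l} → Run K b os cl p q B →
  Nested (suc (suc K)) (suc K) (arcsOf ((b ∷ʳ suc K) ∷ all os cl)) (map proj₂ os) →
  NoncrossingArcs (arcsOf B)
Run-noncrossing end N = Nested.disjoint N
Run-noncrossing {K = K} {b} {os} {cl} (uu r) N = Run-noncrossing r
  (Nested-resp-↭ (arcsOf-extend b (suc K) (suc (suc K)) (all os cl)) (Nested-drop (Nested-push N)))
Run-noncrossing (ud r) N = Run-noncrossing r (Nested-stay (Nested-push N))
Run-noncrossing {K = K} {b} {(b′ , j) ∷ os} {cl} (du r) N = Run-noncrossing r
  (Nested-resp-↭ (begin
    arcsOf ((b′ ∷ʳ j ∷ʳ suc (suc K)) ∷ all os ((b ∷ʳ suc K) ∷ cl))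
      ↭⟨ arcsOf-extend b′ j (suc (suc K)) (all os ((b ∷ʳ suc K) ∷ cl)) ⟩
    (j , suc (suc K)) ∷ arcsOf ((b′ ∷ʳ j) ∷ all os ((b ∷ʳ suc K) ∷ cl))
      ↭⟨ prep _ (arcsOf-↭ (Perm.shift (b ∷ʳ suc K) (block (b′ , j) ∷ map block os) cl)) ⟩
    (j , suc (suc K)) ∷ arcsOf ((b ∷ʳ suc K) ∷ all ((b′ , j) ∷ os) cl) ∎)
    (Nested-drop (Nested-skip N)))
  where open PermutationReasoning
Run-noncrossing {K = K} {b} {os} {cl} (dd r) N = Run-noncrossing r
  (Nested-resp-↭ (arcsOf-↭ (Perm.shift (b ∷ʳ suc K) (map block os) cl)) (Nested-stay (Nested-skip N)))

ζ-lands : ∀ {n} (X : NoncrossingPair n) → Noncrossing (ζ X) × length (blocks (ζ X)) ≡ 1 + n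
ζ-lands {n} X = Run-noncrossing (ζ-Run X) nested ,
  trans (length-Run (ζ-Run X)) (cong suc (trans (ℕ.+-identityʳ _)
    (returns⇒downs n (steps (lower X)) (returns (lower X)))))
  where
  nested : Nested 2 1 [] []
  nested = record { bounded = λ () ; exposed = λ () ; descending = [-] ; disjoint = λ _ _ _ _ () }

-- Injectivity

-- Disjointness in the form in which it is applied: one common element identifies two blocks.
Coherent : List (List ℕ) → Set
Coherent B = ∀ {x b b′} → b ∈ B → b′ ∈ B → x ∈ b → x ∈ b′ → b ≡ b′

Unique-++⇒disjoint : ∀ {x : ℕ} xs {ys} → Unique (xs ++ ys) → x ∈ xs → ¬ x ∈ ys
Unique-++⇒disjoint (x ∷ xs) (x∉ ∷ u) (here refl) y = All.lookup x∉ (∈-++⁺ʳ xs y) refl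
Unique-++⇒disjoint (x ∷ xs) (x∉ ∷ u) (there z)   y = Unique-++⇒disjoint xs u z y

Unique-++ʳ : ∀ (xs : List ℕ) {ys} → Unique (xs ++ ys) → Unique ys
Unique-++ʳ []       u       = u
Unique-++ʳ (x ∷ xs) (_ ∷ u) = Unique-++ʳ xs u

Unique-concat⇒Coherent : ∀ B → Unique (concat B) → Coherent B
Unique-concat⇒Coherent (b ∷ B) u (here refl) (here refl) x x′ = refl
Unique-concat⇒Coherent (b ∷ B) u (here refl) (there m)   x x′ =
  contradiction (∈-concat⁺′ x′ m) (Unique-++⇒disjoint b u x)
Unique-concat⇒Coherent (b ∷ B) u (there m)   (here refl) x x′ =
  contradiction (∈-concat⁺′ x m) (Unique-++⇒disjoint b u x′)
Unique-concat⇒Coherent (b ∷ B) u (there m)   (there m′)  x x′ =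
  Unique-concat⇒Coherent B (Unique-++ʳ b u) m m′ x x′

Unique-blocks : ∀ {m} (R : SetPartition m) → Unique (concat (blocks R))
Unique-blocks {m} R = PermSetoid.Unique-resp-↭ (setoid ℕ) (↭⇒↭ₛ (↭-sym (covers R)))
  (Unique.applyUpTo⁺₁ suc m (λ i<j _ eq → ℕ.<⇒≢ i<j (ℕ.suc-injective eq)))

Coherent-blocks : ∀ {m} (R : SetPartition m) → Coherent (blocks R)
Coherent-blocks R = Unique-concat⇒Coherent (blocks R) (Unique-blocks R)

closed-∈ : ∀ {l K b os cl B c} {p q : Vec Step l} → Run K b os cl p q B → c ∈ cl → c ∈ B
closed-∈ end    m = there m
closed-∈ (uu r) m = closed-∈ r m
closed-∈ (ud r) m = closed-∈ r m
closed-∈ (du r) m = closed-∈ r (there m)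
closed-∈ (dd r) m = closed-∈ r (there m)

snoc-∈ : ∀ (b : List ℕ) {k c B} → (b ∷ʳ k) ++ c ∈ B → b ++ k ∷ c ∈ B
snoc-∈ b = subst (_∈ _) (List.∷ʳ-++ b _ _)

-- The current block may already be complete, whereas an open block must acquire a further element
-- `x`, since the stack is empty at the end. This difference reveals the steps of `p`.
current-∈ : ∀ {l K b os cl B} {p q : Vec Step l} → Run K b os cl p q B →
            ∃[ c ] (b ∷ʳ suc K) ++ c ∈ B
open-∈ : ∀ {l K b os cl B o} {p q : Vec Step l} → Run K b os cl p q B → o ∈ os →
         ∃[ x ] ∃[ c ] block o ++ x ∷ c ∈ B

current-∈ end = [] , here (List.++-identityʳ _)
current-∈ {b = b} (uu r) = _ , snoc-∈ (b ∷ʳ _) (proj₂ (current-∈ r))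
current-∈ (ud r) with x , c , m ← open-∈ r (here refl) = x ∷ c , m
current-∈ (du r) = [] , subst (_∈ _) (sym (List.++-identityʳ _)) (closed-∈ r (here refl))
current-∈ (dd r) = [] , subst (_∈ _) (sym (List.++-identityʳ _)) (closed-∈ r (here refl))

open-∈ (uu r) m = open-∈ r m
open-∈ (ud r) m = open-∈ r (there m)
open-∈ {os = (b , j) ∷ os} (du r) (here refl) = _ , _ , snoc-∈ (b ∷ʳ j) (proj₂ (current-∈ r))
open-∈ (du r) (there m) = open-∈ r m
open-∈ (dd r) m = open-∈ r m

module _ {l K : ℕ} {b : List ℕ} {os : List Open} {cl B : List (List ℕ)}
         {p : Vec Step l} {q : Vec Step (suc l)} where

  continues : Run K b os cl (U ∷ p) q B → ∃[ x ] ∃[ c ] (b ∷ʳ suc K) ++ x ∷ c ∈ B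
  continues (uu r) = _ , _ , snoc-∈ (b ∷ʳ _) (proj₂ (current-∈ r))
  continues (ud r) = open-∈ r (here refl)

  finishes : Run K b os cl (D ∷ p) q B → b ∷ʳ suc K ∈ B
  finishes (du r) = closed-∈ r (here refl)
  finishes (dd r) = closed-∈ r (here refl)

module _ {l K : ℕ} {b : List ℕ} {os : List Open} {cl B : List (List ℕ)}
         {p : Vec Step (suc l)} {q : Vec Step l} where

  succeeds : Run K b os cl p (U ∷ q) B → ∃[ y ] ∃[ j ] ∃[ c ] (y ∷ʳ j) ++ suc (suc K) ∷ c ∈ B
  succeeds (uu r) = b , suc K , _ , snoc-∈ (b ∷ʳ _) (proj₂ (current-∈ r))
  succeeds (du {b′ = b′} {j} r) = b′ , j , _ , snoc-∈ (b′ ∷ʳ j) (proj₂ (current-∈ r))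

  begins : Run K b os cl p (D ∷ q) B → ∃[ c ] suc (suc K) ∷ c ∈ B
  begins (ud r) = current-∈ r
  begins (dd r) = current-∈ r

Linked⇒head-minimal : ∀ {k c} → Linked _<_ (k ∷ c) → All (k <_) c
Linked⇒head-minimal [-]       = []
Linked⇒head-minimal (k<x ∷ l) = Linked⇒All ℕ.<-trans k<x l

-- Otherwise `k` would recur among the elements exceeding the head `k`.
first-minimal : ∀ y {j k c c′} → Linked _<_ (k ∷ c′) → (y ∷ʳ j) ++ k ∷ c ≢ k ∷ c′
first-minimal []      l refl = ℕ.<-irrefl refl (All.lookup (Linked⇒head-minimal l) (here refl))
first-minimal (x ∷ y) l refl = ℕ.<-irrefl refl
  (All.lookup (Linked⇒head-minimal l) (∈-++⁺ʳ (y ∷ʳ _) (here refl)))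

module _ {K : ℕ} {b : List ℕ} {os : List Open} {cl B B′ : List (List ℕ)}
         (co : Coherent B) (B↭B′ : B ↭ B′) where

  upper-agrees : ∀ {l} {p p′ : Vec Step l} {q q′ : Vec Step (suc l)} →
    Run K b os cl (U ∷ p) q B → ¬ Run K b os cl (D ∷ p′) q′ B′
  upper-agrees r r′ with x , c , m ← continues r
    -- Both blocks contain `suc K` and so coincide, yet one of them stops there and the other goes
    -- on.
    with () ← List.++-identityʳ-unique (b ∷ʳ suc K)
      (co (Perm.∈-resp-↭ (↭-sym B↭B′) (finishes r′)) m
        (∈-++⁺ʳ b (here refl)) (∈-++⁺ˡ (∈-++⁺ʳ b (here refl))))

  lower-agrees : ∀ {l} {p p′ : Vec Step (suc l)} {q q′ : Vec Step l} → All (Linked _<_) B →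
    Run K b os cl p (U ∷ q) B → ¬ Run K b os cl p′ (D ∷ q′) B′
  lower-agrees incr r r′ with y , j , c , m ← succeeds r | c′ , m′ ← begins r′ =
    first-minimal y (All.lookup incr m″)
      (co m m″ (∈-++⁺ʳ (y ∷ʳ j) (here refl)) (here refl))
    where m″ = Perm.∈-resp-↭ (↭-sym B↭B′) m′

Coherent-resp-↭ : ∀ {B B′} → B ↭ B′ → Coherent B → Coherent B′
Coherent-resp-↭ B↭B′ co m m′ =
  co (Perm.∈-resp-↭ (↭-sym B↭B′) m) (Perm.∈-resp-↭ (↭-sym B↭B′) m′)

-- The runs are compared in lockstep: from a common situation the blocks force equal first steps,
-- and equal steps lead to a common situation again.
Run-injective : ∀ {l K b os cl B B′} {p q p′ q′ : Vec Step l} →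
  Coherent B → All (Linked _<_) B → B ↭ B′ →
  Run K b os cl p q B → Run K b os cl p′ q′ B′ → p ≡ p′ × q ≡ q′
Run-injective {B = B} {B′} co incr B↭B′ = go
  where
  co′   = Coherent-resp-↭ B↭B′ co
  incr′ = Perm.All-resp-↭ B↭B′ incr
  B′↭B  = ↭-sym B↭B′

  step-injective : ∀ {l K b os cl} {p q p′ q′ : Vec Step (suc l)} →
    Run K b os cl p q B → Run K b os cl p′ q′ B′ →
    head p ≡ head p′ × head q ≡ head q′
  step-injective {p = s ∷ p} {t ∷ q} {s′ ∷ p′} {t′ ∷ q′} r r′ = upper-step s s′ r r′ , lower-step t t′ r r′
    where
    upper-step : ∀ s s′ → Run _ _ _ _ (s ∷ p) (t ∷ q) B → Run _ _ _ _ (s′ ∷ p′) (t′ ∷ q′) B′ → s ≡ s′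
    upper-step U U _ _ = refl
    upper-step U D r r′ = contradiction r′ (upper-agrees co B↭B′ r)
    upper-step D U r r′ = contradiction r (upper-agrees co′ B′↭B r′)
    upper-step D D _ _ = refl
    lower-step : ∀ t t′ → Run _ _ _ _ (s ∷ p) (t ∷ q) B → Run _ _ _ _ (s′ ∷ p′) (t′ ∷ q′) B′ → t ≡ t′
    lower-step U U _ _ = refl
    lower-step U D r r′ = contradiction r′ (lower-agrees co B↭B′ incr r)
    lower-step D U r r′ = contradiction r (lower-agrees co′ B′↭B incr′ r′)
    lower-step D D _ _ = refl

  go : ∀ {l K b os cl} {p q p′ q′ : Vec Step l} →
       Run K b os cl p q B → Run K b os cl p′ q′ B′ → p ≡ p′ × q ≡ q′
  go {p = []}    {[]}    {[]}    {[]}    r r′ = refl , refl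
  go {p = _ ∷ _} {_ ∷ _} {_ ∷ _} {_ ∷ _} r r′ with step-injective r r′ | r | r′
  ... | refl , refl | uu r | uu r′ with refl , refl ← go r r′ = refl , refl
  ... | refl , refl | ud r | ud r′ with refl , refl ← go r r′ = refl , refl
  ... | refl , refl | du r | du r′ with refl , refl ← go r r′ = refl , refl
  ... | refl , refl | dd r | dd r′ with refl , refl ← go r r′ = refl , refl

ζ-injective : ∀ {n} (X Y : NoncrossingPair n) → ζ X ≈ ζ Y → X ≈ᴾ Y
ζ-injective X Y eq =
  Run-injective (Coherent-blocks (ζ X)) (increasing (ζ X)) eq (ζ-Run X) (ζ-Run Y)

-- Surjectivity

-- Identifies the outcome of `ζ` with that of a run built from a given partition.
Run-functional : ∀ {l K b os cl B B′} {p q : Vec Step l} →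
                 Run K b os cl p q B → Run K b os cl p q B′ → B ≡ B′
Run-functional end    end     = refl
Run-functional (uu r) (uu r′) = Run-functional r r′
Run-functional (ud r) (ud r′) = Run-functional r r′
Run-functional (du r) (du r′) = Run-functional r r′
Run-functional (dd r) (dd r′) = Run-functional r r′

++-cancelˡ-↭ : ∀ (xs : List ℕ) {ys zs} → xs ++ ys ↭ xs ++ zs → ys ↭ zs
++-cancelˡ-↭ []       p = p
++-cancelˡ-↭ (x ∷ xs) p = ++-cancelˡ-↭ xs (Perm.drop-∷ p)

nonempty-∈ : ∀ {b : List ℕ} → b ≢ [] → ∃[ x ] x ∈ b
nonempty-∈ {[]}    b≢[] = contradiction refl b≢[]
nonempty-∈ {x ∷ b} _    = x , here refl

-- The blocks of `A` are removed from `B` one at a time. When `A` is used up, the rest of `B` has no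
-- elements, and hence no blocks since these are nonempty.
⊆⇒↭ : ∀ {A B} → All (_≢ []) A → All (_≢ []) B → Unique (concat A) →
      concat A ↭ concat B → All (_∈ B) A → A ↭ B
⊆⇒↭ {[]} {[]} _ _ _ _ _ = ↭-refl
⊆⇒↭ {[]} {[] ∷ B}      _ (b≢[] ∷ _) _ _ _ = contradiction refl b≢[]
⊆⇒↭ {[]} {(x ∷ b) ∷ B} _ _ _ p _ with () ← Perm.↭-empty-inv (↭-sym p)
⊆⇒↭ {a ∷ A} (_ ∷ A≢[]) B≢[] u p (a∈B ∷ A⊆B) with B₁ , B₂ , refl ← ∈-∃++ a∈B =
  ↭-trans (prep a (⊆⇒↭ A≢[] (All.tail (Perm.All-resp-↭ front B≢[])) (Unique-++ʳ a u)
    (++-cancelˡ-↭ a (↭-trans p (concat-↭ front))) (All.tabulate remaining)))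
    (↭-sym front)
  where
  front : B₁ ++ a ∷ B₂ ↭ a ∷ B₁ ++ B₂
  front = Perm.shift a B₁ B₂
  remaining : ∀ {a′} → a′ ∈ A → a′ ∈ B₁ ++ B₂
  remaining a′∈A with Perm.∈-resp-↭ front (All.lookup A⊆B a′∈A)
  ... | there m   = m
  -- A second copy of `a` in `A` would repeat an element of `a`.
  ... | here refl with x , x∈a ← nonempty-∈ (All.lookup A≢[] a′∈A) =
    contradiction (∈-concat⁺′ x∈a a′∈A) (Unique-++⇒disjoint a u x∈a)

Linked-++⁻ : ∀ y {k z} → Linked _<_ (y ++ k ∷ z) → All (_< k) y × All (k <_) z
Linked-++⁻ []       l         = [] , Linked⇒head-minimal l
Linked-++⁻ (x ∷ []) (x<k ∷ l) = x<k ∷ [] , proj₂ (Linked-++⁻ [] l)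
Linked-++⁻ (x ∷ y ∷ ys) (x<y ∷ l) with y<k ∷ ys<k , k<z ← Linked-++⁻ (y ∷ ys) l =
  ℕ.<-trans x<y y<k ∷ y<k ∷ ys<k , k<z

-- The cut falls where the entries first exceed `k`, so the list determines it.
split-unique : ∀ {k} as {bs} cs {ds} → as ++ bs ≡ cs ++ ds →
  All (_≤ k) as → All (k <_) bs → All (_≤ k) cs → All (k <_) ds → as ≡ cs × bs ≡ ds
split-unique []       []       eq _ _ _ _ = refl , eq
split-unique []       (c ∷ cs) refl _ (k<c ∷ _) (c≤k ∷ _) _ = contradiction c≤k (ℕ.<⇒≱ k<c)
split-unique (a ∷ as) []       refl (a≤k ∷ _) _ _ (k<a ∷ _) = contradiction a≤k (ℕ.<⇒≱ k<a)
split-unique (a ∷ as) (c ∷ cs) eq (_ ∷ as≤k) k<bs (_ ∷ cs≤k) k<ds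
  with refl , eq′ ← List.∷-injective eq
  with refl , eq″ ← split-unique as cs eq′ as≤k k<bs cs≤k k<ds = refl , eq″

arc-∈-blockArcs : ∀ y {j k} c → (j , k) ∈ blockArcs ((y ∷ʳ j) ++ k ∷ c)
arc-∈-blockArcs []           c = here refl
arc-∈-blockArcs (x ∷ [])     c = there (here refl)
arc-∈-blockArcs (x ∷ x′ ∷ y) c = there (arc-∈-blockArcs (x′ ∷ y) c)

arc-∈-arcsOf : ∀ y {j k c B} → (y ∷ʳ j) ++ k ∷ c ∈ B → (j , k) ∈ arcsOf B
arc-∈-arcsOf y m = ∈-concat⁺′ (arc-∈-blockArcs y _) (∈-map⁺ blockArcs m)

∈-interval⁻ : ∀ {m x} → x ∈ applyUpTo suc m → 0 < x × x ≤ m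
∈-interval⁻ x∈ with i , i<m , refl ← ∈-applyUpTo⁻ suc x∈ = s≤s z≤n , i<m

∈-interval⁺ : ∀ {m x} → 0 < x → x ≤ m → x ∈ applyUpTo suc m
∈-interval⁺ {x = suc i} _ i<m = ∈-applyUpTo⁺ suc i<m

Sound⇒< : ∀ {k os} → Sound k os → All (λ o → proj₂ o < k) os
Sound⇒< []              = []
Sound⇒< (add _ j<k _ s) = j<k ∷ All.map (λ i<j → ℕ.<-trans i<j j<k) (Sound⇒< s)

-- Matching the soundness evidence lets `odd drop` compute, which exposes the block and the stack in
-- the type.
drop-Middle : ∀ {K b j os cl} → State K ((b , j) ∷ os) cl → Middle K (b ∷ʳ j) os cl
drop-Middle st@(record { sound = add _ _ _ _ }) = proj₁ (proj₂ (proj₂ (proj₂ (odd drop refl st))))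

-- Reading the steps off a noncrossing partition.

module Reconstruction {m} (R : SetPartition m) (nc : Noncrossing R) where

  coherent : Coherent (blocks R)
  coherent = Coherent-blocks R

  element-≤ : ∀ {b x} → b ∈ blocks R → x ∈ b → 0 < x × x ≤ m
  element-≤ b∈R x∈b = ∈-interval⁻ (Perm.∈-resp-↭ (covers R) (∈-concat⁺′ x∈b b∈R))

  Pending : ℕ → Open → Set
  Pending k o = ∃[ x ] ∃[ c ] block o ++ x ∷ c ∈ blocks R × All (k <_) (x ∷ c)

  -- Invariant between two elements: the open blocks are blocks of `R` cut off after `k`, and the
  -- closed ones are whole blocks of `R`.
  record After (k : ℕ) (os : List Open) (cl : List (List ℕ)) : Set where
    field
      state    : State k os cl
      pending  : All (Pending k) os
      finished : All (_∈ blocks R) cl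

  -- The same invariant midway through `suc K`; whether `rest` is empty decides the step of `p`.
  record During (K : ℕ) (b : List ℕ) (os : List Open) (cl : List (List ℕ)) : Set where
    field
      middle   : Middle K b os cl
      rest     : List ℕ
      current  : b ++ suc K ∷ rest ∈ blocks R
      pending  : All (Pending (suc K)) os
      finished : All (_∈ blocks R) cl

  module _ {k os cl} (A : After k os cl) where
    open After A
    open State state

    seen⇒≤ : ∀ {b x} → b ∈ all os cl → x ∈ b → x ≤ k
    seen⇒≤ b∈ x∈b = proj₂ (∈-interval⁻ (Perm.∈-resp-↭ cover (∈-concat⁺′ x∈b b∈)))

    ≤⇒seen : ∀ {x} → 0 < x → x ≤ k → ∃[ b ] x ∈ b × b ∈ all os cl
    ≤⇒seen 0<x x≤k = ∈-concat⁻′ (all os cl) (Perm.∈-resp-↭ (↭-sym cover) (∈-interval⁺ 0<x x≤k))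

    open⇒≤ : ∀ {o} → o ∈ os → All (_≤ k) (block o)
    open⇒≤ o∈os = All.tabulate (seen⇒≤ (∈-++⁺ˡ (∈-map⁺ block o∈os)))

    module _ {y z} (yz∈R : y ++ suc k ∷ z ∈ blocks R) where

      private
        bounds = Linked-++⁻ y (All.lookup (increasing R) yz∈R)
        y≤k = All.map s≤s⁻¹ (proj₁ bounds)
        k<kz : All (k <_) (suc k ∷ z)
        k<kz = ℕ.≤-refl ∷ All.map (ℕ.<-trans ℕ.≤-refl) (proj₂ bounds)

      -- An open block that shares an element with that of suc k is what
      -- precedes suc k in it.
      same-block : ∀ {o x c v} → o ∈ os → block o ++ x ∷ c ∈ blocks R → All (k <_) (x ∷ c) →
        v ∈ block o ++ x ∷ c → v ∈ y ++ suc k ∷ z → block o ≡ y × x ∷ c ≡ suc k ∷ z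
      same-block {o} o∈os m k<xc v∈ v∈′ =
        split-unique (block o) y (coherent m yz∈R v∈ v∈′) (open⇒≤ o∈os) k<xc y≤k k<kz

      -- If the remainder of this open block contained `suc k`, then the open part would be `y`,
      -- which is what precedes `suc k` in its block.
      advance : ∀ {o} → o ∈ os → block o ≢ y → Pending k o → Pending (suc k) o
      advance {o} o∈os o≢y (x , c , m , k<xc) = x , c , m , All.tabulate λ v∈ →
        ℕ.≤∧≢⇒< (All.lookup k<xc v∈) λ { refl →
          o≢y (proj₁ (same-block o∈os m k<xc (∈-++⁺ʳ (block o) v∈) (∈-++⁺ʳ y (here refl)))) }

  module _ {k os cl y j z} (A : After k os cl) (m : (y ∷ʳ j) ++ suc k ∷ z ∈ blocks R) where
    open After A

    private
      j∈ : j ∈ (y ∷ʳ j) ++ suc k ∷ z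
      j∈ = ∈-++⁺ˡ (∈-++⁺ʳ y (here refl))

      j≤k : j ≤ k
      j≤k = s≤s⁻¹ (All.lookup (proj₁ (Linked-++⁻ (y ∷ʳ j) (All.lookup (increasing R) m)))
        (∈-++⁺ʳ y (here refl)))

    -- As `j ≤ k`, it lies in a block already met. That block is not closed, since closed blocks are
    -- whole blocks of `R` and the one of `j` still awaits `suc k`.
    predecessor-open : (y , j) ∈ os
    predecessor-open with b , j∈b , b∈ ← ≤⇒seen A (proj₁ (element-≤ m j∈)) j≤k
      with ∈-++⁻ (map block os) b∈
    ... | inj₂ b∈cl = contradiction (seen⇒≤ A b∈ (subst (suc k ∈_)
            (coherent m (All.lookup finished b∈cl) j∈ j∈b) (∈-++⁺ʳ (y ∷ʳ j) (here refl))))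
            (ℕ.<⇒≱ ℕ.≤-refl)
    ... | inj₁ b∈os with (y′ , j′) , o∈os , refl ← ∈-map⁻ block b∈os
      with x , c , xc∈R , k<xc ← All.lookup pending o∈os
      with refl , refl ← List.∷ʳ-injective y′ y
             (proj₁ (same-block A m o∈os xc∈R k<xc (∈-++⁺ˡ j∈b) j∈)) = o∈os

  -- A later open block above (y , j) would be continued by an arc crossing
  -- (j , suc k).
  predecessor-top : ∀ {k o os cl y j z} → After k (o ∷ os) cl →
    (y ∷ʳ j) ++ suc k ∷ z ∈ blocks R → (y , j) ∈ o ∷ os → o ≡ (y , j)
  predecessor-top A m (here refl) = refl
  predecessor-top {k} {b₁ , j₁} {y = y} {j} A m (there yj∈os)
    with x , c , xc∈R , k<x ∷ k<c ← All.lookup (After.pending A) (here refl)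
    with add _ j₁<k _ so ← State.sound (After.state A)
    = contradiction (j<j₁ , j₁<k , k<x′) (nc _ _ _ _ (arc-∈-arcsOf y m) (arc-∈-arcsOf b₁ xc∈R))
    where
    j<j₁ : j < j₁
    j<j₁ = All.lookup (Sound⇒< so) yj∈os
    k<x′ : suc k < x
    k<x′ = ℕ.≤∧≢⇒< k<x λ { refl → ℕ.<⇒≢ j<j₁ (sym (List.∷ʳ-injectiveʳ b₁ y
      (proj₁ (same-block A m (here refl) xc∈R (k<x ∷ k<c)
        (∈-++⁺ʳ (b₁ ∷ʳ j₁) (here refl)) (∈-++⁺ʳ (y ∷ʳ j) (here refl)))))) }

  -- The alternatives for `suc k`: `extends` gives the step `U` of `q` and `fresh` the step `D`.
  data Next (k : ℕ) (cl : List (List ℕ)) : List Open → Set where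
    extends : ∀ {o os} → During k (block o) os cl → Next k cl (o ∷ os)
    fresh   : ∀ {os}   → During k []        os cl → Next k cl os

  next : ∀ {k os cl} → After k os cl → k < m → Next k cl os
  next {k} {os} {cl} A k<m
    with b , k∈b , b∈R ← ∈-concat⁻′ (blocks R) (Perm.∈-resp-↭ (↭-sym (covers R)) (∈-interval⁺ (s≤s z≤n) k<m))
    with y , z , refl ← ∈-∃++ k∈b with initLast y
  ... | [] = fresh record
    { middle   = proj₁ (proj₂ (proj₂ (proj₂ (odd stay refl state))))
    ; rest     = z
    ; current  = b∈R
    ; pending  = All.tabulate λ {o} o∈os → advance A b∈R o∈os (∷ʳ≢[] (proj₁ o)) (All.lookup pending o∈os)
    ; finished = finished
    }
    where open After A
  ... | y′ ∷ʳ′ j with os | A | predecessor-open A b∈R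
  ...   | o ∷ os′ | A | o∈os with refl ← predecessor-top A b∈R o∈os = extends record
    { middle   = drop-Middle state
    ; rest     = z
    ; current  = b∈R
    -- Lower open blocks end before `j`, so none of them is the block that `suc k` joins.
    ; pending  = All.tabulate λ {o} o∈os → advance A b∈R (there o∈os)
        (λ eq → ℕ.<⇒≢ (All.lookup (earlier (State.sound state)) o∈os) (List.∷ʳ-injectiveʳ (proj₁ o) y′ eq))
        (All.lookup pending (there o∈os))
    ; finished = finished
    }
    where
    open After A
    earlier : ∀ {k b j os} → Sound k ((b , j) ∷ os) → All (λ o → proj₂ o < j) os
    earlier (add _ _ _ s) = Sound⇒< s

  module _ {K b os cl} (M : During K b os cl) where
    open During M

    postpone : ∀ {x c} → rest ≡ x ∷ c → After (suc K) ((b , suc K) ∷ os) cl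
    postpone refl = record
      { state    = proj₁ (proj₂ (proj₂ (even refl lift middle)))
      ; pending  = (_ , _ , subst (_∈ blocks R) (sym (List.∷ʳ-++ b (suc K) _)) current ,
                    proj₂ (Linked-++⁻ b (All.lookup (increasing R) current))) ∷ pending
      ; finished = finished
      }

    current-finished : rest ≡ [] → All (_∈ blocks R) ((b ∷ʳ suc K) ∷ cl)
    current-finished refl = current ∷ finished

    complete : rest ≡ [] → After (suc K) os ((b ∷ʳ suc K) ∷ cl)
    complete refl = record
      { state    = proj₁ (proj₂ (proj₂ (even refl stay middle)))
      ; pending  = pending
      ; finished = current-finished refl
      }

  private
    shift-length : ∀ {K l} → suc K + suc l ≡ m → suc (suc K) + l ≡ m
    shift-length {K} {l} len = trans (sym (ℕ.+-suc (suc K) l)) len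

    more : ∀ {K l} → suc K + suc l ≡ m → suc K < m
    more {K} len = subst (suc K <_) len (ℕ.m<m+n (suc K) (s≤s z≤n))

    none-pending : ∀ {K o} → suc K + 0 ≡ m → ¬ Pending (suc K) o
    none-pending {K} {o} len (x , c , xc∈R , k<x ∷ _) = ℕ.<⇒≱ k<x
      (subst (_ ≤_) (trans (sym len) (ℕ.+-identityʳ (suc K)))
        (proj₂ (element-≤ xc∈R (∈-++⁺ʳ (block o) (here refl)))))

  -- Induction on the number `l` of elements left. When none is left, a pending block would need an
  -- element beyond `m`, so the stack is empty and the current block is complete.
  rebuild : ∀ l K {b os cl} → suc K + l ≡ m → During K b os cl →
    ∃[ p ] ∃[ q ] ∃[ B ] Run {l} K b os cl p q B × B ↭ blocks R
  rebuild zero K {os = _ ∷ _} len M = contradiction (All.head (During.pending M)) (none-pending len)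
  rebuild zero K {b} {[]} {cl} len M with During.rest M in eq
  ... | _ ∷ _ = contradiction (All.head (After.pending (postpone M eq))) (none-pending len)
  ... | [] = [] , [] , (b ∷ʳ suc K) ∷ cl , end ,
    -- The blocks found belong to `R` and together have the elements `1` to `m`, so they are all of
    -- its blocks.
    ⊆⇒↭ full (nonempty R) unique cover′ (current-finished M eq)
    where
    open After (complete M eq)
    open State state
    cover′ : concat ((b ∷ʳ suc K) ∷ cl) ↭ concat (blocks R)
    cover′ = ↭-trans cover (↭-trans (↭-reflexive (cong (applyUpTo suc)
      (trans (sym (ℕ.+-identityʳ (suc K))) len))) (↭-sym (covers R)))
    unique : Unique (concat ((b ∷ʳ suc K) ∷ cl))
    unique = PermSetoid.Unique-resp-↭ (setoid ℕ) (↭⇒↭ₛ (↭-sym cover′)) (Unique-blocks R)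
  rebuild (suc l) K len M with During.rest M in eq
  ... | x ∷ c with next (postpone M eq) (more len)
  ...   | extends M′ with p , q , B , r , B↭ ← rebuild l (suc K) (shift-length len) M′ =
    U ∷ p , U ∷ q , B , uu r , B↭
  ...   | fresh M′   with p , q , B , r , B↭ ← rebuild l (suc K) (shift-length len) M′ =
    U ∷ p , D ∷ q , B , ud r , B↭
  rebuild (suc l) K {os = os} len M | [] with os | next (complete M eq) (more len)
  ... | _ | extends M′ with p , q , B , r , B↭ ← rebuild l (suc K) (shift-length len) M′ =
    D ∷ p , U ∷ q , B , du r , B↭
  ... | _ | fresh M′   with p , q , B , r , B↭ ← rebuild l (suc K) (shift-length len) M′ =
    D ∷ p , D ∷ q , B , dd r , B↭

  reconstruct : ∀ l → suc l ≡ m →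
    ∃[ p ] ∃[ q ] ∃[ B ] Run {l} 0 [] [] [] p q B × B ↭ blocks R
  -- Element 1 meets an empty stack and begins a block. This consumes no step, as the first step of
  -- `q` concerns element 2.
  reconstruct l refl with next {0} record { state = start ; pending = [] ; finished = [] } (s≤s z≤n)
  ... | fresh M = rebuild l 0 refl M

ζ-surjective : ∀ {n} (R : NC (1 + 2 * n) (1 + n)) →
  ∃[ X ] (∀ {Z} → Z ≈ᴾ X → ζ {n} Z ≈ proj₁ R)
ζ-surjective {n} (R , nc , size)
  with p , q , B , r , B↭ ← Reconstruction.reconstruct R nc (2 * n) refl = X , onto
  where
  returns-q : height q (fromℕ (2 * n)) ≡ 0ℤ
  -- The run yields `suc (downs q)` blocks and `R` has `1 + n`.
  returns-q = downs⇒returns n q (ℕ.suc-injective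
    (trans (cong suc (sym (ℕ.+-identityʳ (downs q))))
      (trans (sym (length-Run r)) (trans (Perm.↭-length B↭) size))))

  X : NoncrossingPair n
  X = record
    { upper       = record
        { steps   = p
        ; returns = trans (sym (trans (Run-Meet r) (ℤ.+-identityʳ _))) returns-q }
    ; lower       = record { steps = q ; returns = returns-q }
    ; noncrossing = λ x → subst (ℤ._≤_ (height q x)) (ℤ.+-identityʳ _) (Run-Above r x)
    }

  onto : ∀ {Z} → Z ≈ᴾ X → ζ Z ≈ R
  onto {Z} (refl , refl) = ↭-trans (↭-reflexive (Run-functional (ζ-Run Z) r)) B↭

theorem2p4 : ∀ n → .{{_ : NonZero n}} →
    Σ[ lands ∈ (∀ (X : NoncrossingPair n) → Noncrossing (ζ X) × length (blocks (ζ X)) ≡ 1 + n) ]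
    Bijective (_≈ᴾ_ {n}) (_≈ᴺ_ {1 + 2 * n} {1 + n}) (λ X → ζ X , lands X)
theorem2p4 n = ζ-lands , (λ {X} {Y} → ζ-injective X Y) , ζ-surjective
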